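{- For all integers $k\ge 1$ and $n\ge 0$, we have $\gamma_{2,3,5,5/2,1/2}^k(n)\ge 0$; that is, the coefficient of $q^n$ in $$\frac{1}{(1-q^2)(1-q^3)(1-q^5)}\sum_{j\notin[-k,k-1]}(-1)^{j+k}q^{j(5j+1)/2}$$ is nonnegative.
   Context: Identities are between formal power series in $q$. The sum $\sum_{j\notin[-k,k-1]}$ is over all integers $j\le -k-1$ and all integers $j\ge k$. In general $\gamma_{a,b,c,A,B}^k(n)$ is defined by $\frac{1}{(1-q^a)(1-q^b)(1-q^c)}\sum_{j\notin[-k,k-1]}(-1)^{j+k}q^{Aj^2+Bj}=\sum_{n\ge0}\gamma_{a,b,c,A,B}^k(n)q^n$. -}

module Defs where

open import Data.Bool.Base using (if_then_else_)
open import Data.Fin.Base using (Fin; zero; suc; toℕ)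
open import Data.Integer.Base as ℤ using (ℤ; +_; 0ℤ; 1ℤ; -1ℤ; ∣_∣)
import Data.Integer.Properties as ℤ
open import Data.Nat.Base as ℕ using (ℕ; zero; suc; _∸_; NonZero; s≤s)
import Data.Nat.Properties as ℕ
import Data.Nat.Tactic.RingSolver as ℕSolver
import Data.Integer.Tactic.RingSolver as ℤSolver
open import Data.Rational.Unnormalised.Base as ℚ
  using (ℚᵘ; mkℚᵘ; _/_; _≃_; *≡*; ↥_; ↧ₙ_)
open import Data.Rational.Unnormalised.Properties using (_≃?_)
open import Data.Vec.Base using (Vec; []; _∷_; head; lookup)
open import Relation.Binary.PropositionalEquality
open import Relation.Nullary.Decidable using (does; dec-false)
open import Relation.Nullary.Negation using (¬_)
open import Algebra.Properties.CommutativeMonoid.Sum ℤ.+-0-commutativeMonoid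
  using (sum⁺-syntax; sum-cong-≗)

-- Formal power series in q with integer coefficients: f n is the coefficient
-- of qⁿ.
Series : Set
Series = ℕ → ℤ

infixl 6 _⊝_
infixl 7 _⊛_

_⊝_ : Series → Series → Series
(f ⊝ g) n = f n ℤ.- g n

_⊛_ : Series → Series → Series
(f ⊛ g) n = ∑[ i ≤ n ] (f (toℕ i) ℤ.* g (n ∸ toℕ i))

-- Exponents are rational so that A j² + B j can be written as such for
-- half-integral A and B.  If e is not a natural number, q^ e is 0; this never
-- happens for A = 5/2, B = 1/2.
q^_ : ℚᵘ → Series
(q^ e) n = if does (e ≃? (+ n / 1)) then 1ℤ else 0ℤ

𝟙 : Series
𝟙 = q^ (+ 0 / 1)

1-q^_ : ℕ → Series
1-q^ a = 𝟙 ⊝ q^ (+ a / 1)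

-- The multiplicative inverse of a series f with constant coefficient 1 (see
-- ⊛-recip).  Its coefficients solve g₀ = 1, gₙ₊₁ = - ∑_{i ≤ n} fᵢ₊₁ gₙ₋ᵢ;
-- recips f n is the vector gₙ, gₙ₋₁, …, g₀.
recips : Series → ∀ n → Vec ℤ (suc n)
recips f zero    = 1ℤ ∷ []
recips f (suc n) =
  ℤ.- (∑[ i ≤ n ] (f (suc (toℕ i)) ℤ.* lookup (recips f n) i)) ∷ recips f n

recip : Series → Series
recip f n = head (recips f n)

lookup-recips : ∀ f n i → lookup (recips f n) i ≡ recip f (n ∸ toℕ i)
lookup-recips f zero    zero    = refl
lookup-recips f (suc n) zero    = refl
lookup-recips f (suc n) (suc i) = lookup-recips f n i

⊛-recip : ∀ f → f 0 ≡ 1ℤ → ∀ n → (f ⊛ recip f) n ≡ 𝟙 n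
⊛-recip f f0≡1 zero    rewrite f0≡1 = refl
⊛-recip f f0≡1 (suc n) rewrite f0≡1 = begin
  1ℤ ℤ.* (ℤ.- S) ℤ.+ T ≡⟨ cong₂ ℤ._+_ (ℤ.*-identityˡ (ℤ.- S)) (sum-cong-≗ T≗S) ⟩
  ℤ.- S ℤ.+ S          ≡⟨ ℤ.+-inverseˡ S ⟩
  0ℤ                   ∎
  where
  open ≡-Reasoning
  S = ∑[ i ≤ n ] (f (suc (toℕ i)) ℤ.* lookup (recips f n) i)
  T = ∑[ i ≤ n ] (f (suc (toℕ i)) ℤ.* recip f (n ∸ toℕ i))
  T≗S : ∀ (i : Fin (suc n)) → f (suc (toℕ i)) ℤ.* recip f (n ∸ toℕ i)
                            ≡ f (suc (toℕ i)) ℤ.* lookup (recips f n) i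
  T≗S i = cong (f (suc (toℕ i)) ℤ.*_) (sym (lookup-recips f n i))

exponent : (A B : ℚᵘ) → ℤ → ℚᵘ
exponent A B j = A ℚ.* ((j / 1) ℚ.* (j / 1)) ℚ.+ B ℚ.* (j / 1)

-- (-1)^(j+k) q^(A j² + B j); the sign depends only on the parity of j + k, so
-- the absolute value makes no difference.
term : (A B : ℚᵘ) (k : ℕ) → ℤ → Series
term A B k j n = -1ℤ ℤ.^ ∣ j ℤ.+ + k ∣ ℤ.* (q^ exponent A B j) n

-- Only integers j with ∣ j ∣ ≤ cutoff A B n can contribute to the coefficient
-- of qⁿ (see term-vanishes).
cutoff : (A B : ℚᵘ) → ℕ → ℕ
cutoff A B n = n ℕ.+ suc ∣ ↥ B ∣ ℕ.* ↧ₙ A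

-- ∑_{j ∉ [-k,k-1]} (-1)^(j+k) q^(A j² + B j), for A ≠ 0.  The integers
-- j ∉ [-k,k-1] are the k + i and the -k-1-i for i ≥ 0; those omitted by the
-- upper limit on i contribute nothing to the coefficient of qⁿ.
tail-sum : (A B : ℚᵘ) (k : ℕ) → Series
tail-sum A B k n = ∑[ i ≤ cutoff A B n ]
  (term A B k (+ (k ℕ.+ toℕ i)) n ℤ.+ term A B k (ℤ.- + (suc k ℕ.+ toℕ i)) n)

private
  cutoff-ℕ : ∀ n p J r D E → .{{NonZero p}} → .{{NonZero D}} → .{{NonZero E}} →
             n ℕ.+ suc r ℕ.* D ℕ.< J →
             n ℕ.* (D ℕ.* E) ℕ.+ r ℕ.* J ℕ.* D ℕ.< p ℕ.* (J ℕ.* J) ℕ.* E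
  cutoff-ℕ n p J@(suc _) r D E N<J = begin-strict
    n ℕ.* (D ℕ.* E) ℕ.+ r ℕ.* J ℕ.* D
      <⟨ ℕ.+-monoˡ-< (r ℕ.* J ℕ.* D) (ℕ.*-monoˡ-< (D ℕ.* E) {{ℕ.m*n≢0 D E}} n<J) ⟩
    J ℕ.* (D ℕ.* E) ℕ.+ r ℕ.* J ℕ.* D
      ≤⟨ ℕ.+-monoʳ-≤ (J ℕ.* (D ℕ.* E)) (ℕ.m≤m*n (r ℕ.* J ℕ.* D) E) ⟩
    J ℕ.* (D ℕ.* E) ℕ.+ r ℕ.* J ℕ.* D ℕ.* E
      ≡⟨ rearrange J D E r ⟩
    suc r ℕ.* D ℕ.* (J ℕ.* E)
      ≤⟨ ℕ.*-monoˡ-≤ (J ℕ.* E) (ℕ.≤-trans (ℕ.m≤n+m (suc r ℕ.* D) n) (ℕ.<⇒≤ N<J)) ⟩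
    J ℕ.* (J ℕ.* E)
      ≡⟨ ℕ.*-assoc J J E ⟨
    J ℕ.* J ℕ.* E
      ≤⟨ ℕ.*-monoˡ-≤ E (ℕ.m≤n*m (J ℕ.* J) p) ⟩
    p ℕ.* (J ℕ.* J) ℕ.* E ∎
    where
    open ℕ.≤-Reasoning
    n<J : n ℕ.< J
    n<J = ℕ.≤-<-trans (ℕ.m≤m+n n (suc r ℕ.* D)) N<J
    rearrange : ∀ J D E r → J ℕ.* (D ℕ.* E) ℕ.+ r ℕ.* J ℕ.* D ℕ.* E
                          ≡ (1 ℕ.+ r) ℕ.* D ℕ.* (J ℕ.* E)
    rearrange = ℕSolver.solve-∀

exponent≄ : ∀ A B n j → .{{NonZero ∣ ↥ A ∣}} → cutoff A B n ℕ.< ∣ j ∣ →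
            ¬ (exponent A B j ≃ + n / 1)
exponent≄ A@(mkℚᵘ p d) B@(mkℚᵘ r e) n j N<∣j∣ (*≡* eq) =
  ℕ.<⇒≱ (cutoff-ℕ n (∣ p ∣) (∣ j ∣) (∣ r ∣) (suc d) (suc e) N<∣j∣) (begin
    ∣ p ∣ ℕ.* (∣ j ∣ ℕ.* ∣ j ∣) ℕ.* suc e
      ≡⟨ abs-lhs ⟨
    ∣ p ℤ.* (j ℤ.* j) ℤ.* + suc e ∣
      ≡⟨ cong ∣_∣ cleared ⟩
    ∣ + n ℤ.* (+ suc d ℤ.* + suc e) ℤ.- r ℤ.* j ℤ.* + suc d ∣
      ≤⟨ ℤ.∣i-j∣≤∣i∣+∣j∣ (+ n ℤ.* (+ suc d ℤ.* + suc e)) (r ℤ.* j ℤ.* + suc d) ⟩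
    ∣ + n ℤ.* (+ suc d ℤ.* + suc e) ∣ ℕ.+ ∣ r ℤ.* j ℤ.* + suc d ∣
      ≡⟨ cong₂ ℕ._+_ abs-n abs-r ⟩
    n ℕ.* (suc d ℕ.* suc e) ℕ.+ ∣ r ∣ ℕ.* ∣ j ∣ ℕ.* suc d ∎)
  where
  open ℕ.≤-Reasoning
  abs-lhs : ∣ p ℤ.* (j ℤ.* j) ℤ.* + suc e ∣ ≡ ∣ p ∣ ℕ.* (∣ j ∣ ℕ.* ∣ j ∣) ℕ.* suc e
  abs-lhs rewrite ℤ.abs-* (p ℤ.* (j ℤ.* j)) (+ suc e) | ℤ.abs-* p (j ℤ.* j)
                | ℤ.abs-* j j = refl
  abs-n : ∣ + n ℤ.* (+ suc d ℤ.* + suc e) ∣ ≡ n ℕ.* (suc d ℕ.* suc e)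
  abs-n = ℤ.abs-* (+ n) (+ suc d ℤ.* + suc e)
  abs-r : ∣ r ℤ.* j ℤ.* + suc d ∣ ≡ ∣ r ∣ ℕ.* ∣ j ∣ ℕ.* suc d
  abs-r rewrite ℤ.abs-* (r ℤ.* j) (+ suc d) | ℤ.abs-* r j = refl
  D E : ℤ
  D = + (suc d ℕ.* 1)
  E = + (suc e ℕ.* 1)
  D≡ : D ≡ + suc d
  D≡ = cong +_ (ℕ.*-identityʳ (suc d))
  E≡ : E ≡ + suc e
  E≡ = cong +_ (ℕ.*-identityʳ (suc e))
  isolate : ∀ x y z → (x ℤ.+ y) ℤ.* 1ℤ ≡ z → x ≡ z ℤ.- y
  isolate x y z h = trans (lemma x y) (cong (ℤ._- y) h)
    where
    lemma : ∀ x y → x ≡ (x ℤ.+ y) ℤ.* 1ℤ ℤ.- y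
    lemma = ℤSolver.solve-∀
  cleared : p ℤ.* (j ℤ.* j) ℤ.* + suc e
          ≡ + n ℤ.* (+ suc d ℤ.* + suc e) ℤ.- r ℤ.* j ℤ.* + suc d
  cleared = subst₂ (λ x y → p ℤ.* (j ℤ.* j) ℤ.* y ≡ + n ℤ.* (x ℤ.* y) ℤ.- r ℤ.* j ℤ.* x)
    D≡ E≡ (isolate (p ℤ.* (j ℤ.* j) ℤ.* E) (r ℤ.* j ℤ.* D) (+ n ℤ.* (D ℤ.* E)) eq)

term-vanishes : ∀ A B k n j → .{{NonZero ∣ ↥ A ∣}} → cutoff A B n ℕ.< ∣ j ∣ →
                term A B k j n ≡ 0ℤ
term-vanishes A B k n j N<∣j∣ = trans
  (cong (λ b → sign ℤ.* (if b then 1ℤ else 0ℤ))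
    (dec-false (exponent A B j ≃? (+ n / 1)) (exponent≄ A B n j N<∣j∣)))
  (ℤ.*-zeroʳ sign)
  where
  sign = -1ℤ ℤ.^ ∣ j ℤ.+ + k ∣

-- γ a b c A B k n is γ^k_{a,b,c,A,B}(n), for a, b, c ≥ 1 and A > 0; it matches
-- the usual definition only in that range, where the denominator has constant
-- coefficient 1 and the sum over j has finitely many terms in each degree.
γ : (a b c : ℕ) (A B : ℚᵘ) (k : ℕ) → Series
γ a b c A B k = recip (1-q^ a ⊛ 1-q^ b ⊛ 1-q^ c) ⊛ tail-sum A B k

{-# OPTIONS --safe #-}
module Submission where

-- Put e(k) = k(5k+1)/2, let p be the coefficients of 1/((1-q²)(1-q³)(1-q⁵)) and
-- Γ k x = γ^k(e(k) + x).  Consecutive tail sums telescope, which gives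
--   Γ k x = p(x) − p(x − 4k − 2) − Γ (k + 1) (x − 5k − 3),
-- where terms with a negative argument are 0.  Since p(x) = (x + 5)²/60 up to an
-- error of at most 36/60, induction on x along this recursion shows that Γ k x is
-- kx/15 + (k² + 13k)/30 up to a slack that is small enough to yield positivity,
-- except for k ≤ 4 and x < 850, where finitely many values are computed.

open import Defs
open import Data.Bool.Base using (if_then_else_)
open import Data.Fin.Base using (Fin; zero; suc; toℕ; inject₁; fromℕ)
import Data.Fin.Properties as Fin
open import Data.Integer.Base as ℤ using (ℤ; +_; -[1+_]; 0ℤ; 1ℤ; -1ℤ; ∣_∣; +≤+; _≤_)
import Data.Integer.Properties as ℤ
open import Data.Integer.Solver using (module +-*-Solver)
import Data.Integer.Tactic.RingSolver as ℤSolver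
open import Data.Nat.Base as ℕ using (ℕ; zero; suc; _∸_; _%_; z≤n; s≤s)
import Data.Nat.DivMod as ℕ
import Data.Nat.Properties as ℕ
import Data.Nat.Tactic.RingSolver as ℕSolver
open import Data.Product.Base using (_×_; _,_; ∃-syntax; proj₁; proj₂; uncurry)
open import Data.Sum.Base using (_⊎_; inj₁; inj₂; [_,_]′)
open import Data.Rational.Unnormalised.Base using (ℚᵘ; _/_; _≃_; *≡*)
import Data.Rational.Unnormalised.Properties as ℚ
open import Function.Base using (_∘_)
open import Function.Bundles using (mk⇔)
open import Relation.Binary.PropositionalEquality
open import Relation.Nullary.Decidable using (does; does-⇔; from-yes; _×-dec_; yes; no)
open import Algebra.Properties.CommutativeMonoid.Sum ℤ.+-0-commutativeMonoid
  using (sum; sum⁺-syntax; sum-cong-≗; ∑-distrib-+; sum-init-last; sum-replicate-zero)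
open +-*-Solver using (Polynomial; solve; con; _:=_; _:+_; _:*_; _:-_)

-- Power series

-- Multiplication by qᵃ, by recursion on both arguments so that it computes on numerals.
shift : ℕ → Series → Series
shift zero    f n       = f n
shift (suc a) f zero    = 0ℤ
shift (suc a) f (suc n) = shift a f n

shift-+ : ∀ a f n → shift a f (a ℕ.+ n) ≡ f n
shift-+ zero    f n = refl
shift-+ (suc a) f n = shift-+ a f n

shift-< : ∀ {a n} f → n ℕ.< a → shift a f n ≡ 0ℤ
shift-< {suc a} {zero}  f _         = refl
shift-< {suc a} {suc n} f (s≤s n<a) = shift-< f n<a

shift-cong : ∀ a {f g} → f ≗ g → shift a f ≗ shift a g
shift-cong zero    f≗g n       = f≗g n
shift-cong (suc a) f≗g zero    = refl
shift-cong (suc a) f≗g (suc n) = shift-cong a f≗g n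

⊛-congˡ : ∀ f {g h} → g ≗ h → f ⊛ g ≗ f ⊛ h
⊛-congˡ f g≗h n = sum-cong-≗ {suc n} λ i → cong (f (toℕ i) ℤ.*_) (g≗h (n ∸ toℕ i))

⊛-congʳ : ∀ h {f g} → f ≗ g → f ⊛ h ≗ g ⊛ h
⊛-congʳ h f≗g n = sum-cong-≗ {suc n} λ i → cong (ℤ._* h (n ∸ toℕ i)) (f≗g (toℕ i))

⊝-cong : ∀ {f f′ g g′} → f ≗ f′ → g ≗ g′ → f ⊝ g ≗ f′ ⊝ g′
⊝-cong f≗f′ g≗g′ n = cong₂ ℤ._-_ (f≗f′ n) (g≗g′ n)

sum-neg : ∀ {n} (t : Fin n → ℤ) → sum (λ i → ℤ.- t i) ≡ ℤ.- sum t
sum-neg {zero}  t = refl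
sum-neg {suc n} t = trans (cong (λ s → ℤ.- t zero ℤ.+ s) (sum-neg (t ∘ suc)))
  (sym (ℤ.neg-distrib-+ (t zero) (sum (t ∘ suc))))

sum-minus : ∀ {n} (s t : Fin n → ℤ) → sum (λ i → s i ℤ.- t i) ≡ sum s ℤ.- sum t
sum-minus s t = trans (∑-distrib-+ s (λ i → ℤ.- t i)) (cong (λ x → sum s ℤ.+ x) (sum-neg t))

⊛-distribʳ-⊝ : ∀ f g h → (f ⊝ g) ⊛ h ≗ (f ⊛ h) ⊝ (g ⊛ h)
⊛-distribʳ-⊝ f g h n = trans
  (sum-cong-≗ {suc n} λ i → distrib (f (toℕ i)) (g (toℕ i)) (h (n ∸ toℕ i)))
  (sum-minus {suc n} (λ i → f (toℕ i) ℤ.* h (n ∸ toℕ i)) (λ i → g (toℕ i) ℤ.* h (n ∸ toℕ i)))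
  where
  distrib : ∀ x y z → (x ℤ.- y) ℤ.* z ≡ x ℤ.* z ℤ.- y ℤ.* z
  distrib = ℤSolver.solve-∀

⊛-distribˡ-⊝ : ∀ f g h → f ⊛ (g ⊝ h) ≗ (f ⊛ g) ⊝ (f ⊛ h)
⊛-distribˡ-⊝ f g h n = trans
  (sum-cong-≗ {suc n} λ i → distrib (f (toℕ i)) (g (n ∸ toℕ i)) (h (n ∸ toℕ i)))
  (sum-minus {suc n} (λ i → f (toℕ i) ℤ.* g (n ∸ toℕ i)) (λ i → f (toℕ i) ℤ.* h (n ∸ toℕ i)))
  where
  distrib : ∀ x y z → x ℤ.* (y ℤ.- z) ≡ x ℤ.* y ℤ.- x ℤ.* z
  distrib = ℤSolver.solve-∀

⊛-distribˡ-+ : ∀ f g h n → (f ⊛ g) n ℤ.+ (f ⊛ h) n ≡ (f ⊛ (λ m → g m ℤ.+ h m)) n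
⊛-distribˡ-+ f g h n = trans
  (sym (∑-distrib-+ {suc n} (λ i → f (toℕ i) ℤ.* g (n ∸ toℕ i)) (λ i → f (toℕ i) ℤ.* h (n ∸ toℕ i))))
  (sum-cong-≗ {suc n} λ i → sym (ℤ.*-distribˡ-+ (f (toℕ i)) (g (n ∸ toℕ i)) (h (n ∸ toℕ i))))

shift1-⊛ : ∀ f g → shift 1 f ⊛ g ≗ shift 1 (f ⊛ g)
shift1-⊛ f g zero    = refl
shift1-⊛ f g (suc n) = ℤ.+-identityˡ ((f ⊛ g) n)

⊛-shift1 : ∀ f g → f ⊛ shift 1 g ≗ shift 1 (f ⊛ g)
⊛-shift1 f g zero    = trans (ℤ.+-identityʳ (f 0 ℤ.* 0ℤ)) (ℤ.*-zeroʳ (f 0))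
⊛-shift1 f g (suc n) = begin
  -- The last summand carries `shift 1 g 0`, which is 0; the others lose the shift.
  sum summand                                    ≡⟨ sum-init-last summand ⟩
  sum (summand ∘ inject₁) ℤ.+ summand (fromℕ (suc n)) ≡⟨ cong₂ ℤ._+_ (sum-cong-≗ init≗) last≡0 ⟩
  (f ⊛ g) n ℤ.+ 0ℤ                               ≡⟨ ℤ.+-identityʳ ((f ⊛ g) n) ⟩
  (f ⊛ g) n                                      ∎
  where
  open ≡-Reasoning
  summand : Fin (suc (suc n)) → ℤ
  summand i = f (toℕ i) ℤ.* shift 1 g (suc n ∸ toℕ i)
  init≗ : ∀ i → summand (inject₁ i) ≡ f (toℕ i) ℤ.* g (n ∸ toℕ i)
  init≗ i rewrite Fin.toℕ-inject₁ i | ℕ.+-∸-assoc 1 (Fin.toℕ≤pred[n] i) = refl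
  last≡0 : summand (fromℕ (suc n)) ≡ 0ℤ
  last≡0 rewrite Fin.toℕ-fromℕ n | ℕ.n∸n≡0 n = ℤ.*-zeroʳ (f (suc n))

shift-suc : ∀ a f → shift (suc a) f ≗ shift 1 (shift a f)
shift-suc a f zero    = refl
shift-suc a f (suc n) = refl

shift-⊛ : ∀ a f g → shift a f ⊛ g ≗ shift a (f ⊛ g)
shift-⊛ zero    f g n = refl
shift-⊛ (suc a) f g n = begin
  (shift (suc a) f ⊛ g) n       ≡⟨ ⊛-congʳ g (shift-suc a f) n ⟩
  (shift 1 (shift a f) ⊛ g) n   ≡⟨ shift1-⊛ (shift a f) g n ⟩
  shift 1 (shift a f ⊛ g) n     ≡⟨ shift-cong 1 (shift-⊛ a f g) n ⟩
  shift 1 (shift a (f ⊛ g)) n   ≡⟨ shift-suc a (f ⊛ g) n ⟨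
  shift (suc a) (f ⊛ g) n       ∎
  where open ≡-Reasoning

⊛-shift : ∀ a f g → f ⊛ shift a g ≗ shift a (f ⊛ g)
⊛-shift zero    f g n = refl
⊛-shift (suc a) f g n = begin
  (f ⊛ shift (suc a) g) n       ≡⟨ ⊛-congˡ f (shift-suc a g) n ⟩
  (f ⊛ shift 1 (shift a g)) n   ≡⟨ ⊛-shift1 f (shift a g) n ⟩
  shift 1 (f ⊛ shift a g) n     ≡⟨ shift-cong 1 (⊛-shift a f g) n ⟩
  shift 1 (shift a (f ⊛ g)) n   ≡⟨ shift-suc a (f ⊛ g) n ⟨
  shift (suc a) (f ⊛ g) n       ∎
  where open ≡-Reasoning

sum-zero : ∀ {n} {t : Fin n → ℤ} → (∀ i → t i ≡ 0ℤ) → sum t ≡ 0ℤ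
sum-zero {n} t≡0 = trans (sum-cong-≗ t≡0) (sum-replicate-zero n)

⊛-identityˡ : ∀ f → 𝟙 ⊛ f ≗ f
⊛-identityˡ f n = begin
  1ℤ ℤ.* f n ℤ.+ sum rest ≡⟨ cong₂ ℤ._+_ (ℤ.*-identityˡ (f n)) (sum-zero rest≡0) ⟩
  f n ℤ.+ 0ℤ              ≡⟨ ℤ.+-identityʳ (f n) ⟩
  f n                     ∎
  where
  open ≡-Reasoning
  rest : Fin n → ℤ
  rest i = 𝟙 (suc (toℕ i)) ℤ.* f (n ∸ suc (toℕ i))
  rest≡0 : ∀ i → rest i ≡ 0ℤ
  -- `𝟙` computes to 0 at a successor, and `0ℤ` times anything reduces to `0ℤ`.
  rest≡0 i = refl

⊛-identityʳ : ∀ f → f ⊛ 𝟙 ≗ f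
⊛-identityʳ f zero    = trans (ℤ.+-identityʳ (f 0 ℤ.* 1ℤ)) (ℤ.*-identityʳ (f 0))
⊛-identityʳ f (suc n) = begin
  f 0 ℤ.* 0ℤ ℤ.+ ((f ∘ suc) ⊛ 𝟙) n ≡⟨ cong₂ ℤ._+_ (ℤ.*-zeroʳ (f 0)) (⊛-identityʳ (f ∘ suc) n) ⟩
  0ℤ ℤ.+ f (suc n)                 ≡⟨ ℤ.+-identityˡ (f (suc n)) ⟩
  f (suc n)                        ∎
  where open ≡-Reasoning

q^-cong : ∀ {d e} → d ≃ e → q^ d ≗ q^ e
q^-cong {d} {e} d≃e n = cong (if_then 1ℤ else 0ℤ) (does-⇔
  (mk⇔ (ℚ.≃-trans (ℚ.≃-sym d≃e)) (ℚ.≃-trans d≃e)) (d ℚ.≃? (+ n / 1)) (e ℚ.≃? (+ n / 1)))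

-- Trades the comparison of rational exponents for one of natural numbers.
q^-shift : ∀ a → q^ (+ a / 1) ≗ shift a 𝟙
q^-shift a n = trans (cong (if_then 1ℤ else 0ℤ) (does-⇔ (mk⇔ to from) ((+ a / 1) ℚ.≃? (+ n / 1)) (a ℕ.≟ n))) (indicator a n)
  where
  to : + a / 1 ≃ + n / 1 → a ≡ n
  to (*≡* eq) = ℤ.+-injective (trans (sym (ℤ.*-identityʳ (+ a))) (trans eq (ℤ.*-identityʳ (+ n))))
  from : a ≡ n → + a / 1 ≃ + n / 1
  from refl = *≡* refl
  indicator : ∀ a n → (if does (a ℕ.≟ n) then 1ℤ else 0ℤ) ≡ shift a 𝟙 n
  indicator zero    zero    = refl
  indicator zero    (suc n) = refl
  indicator (suc a) zero    = refl
  indicator (suc a) (suc n) = indicator a n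

1-q^-⊛ : ∀ a f → 1-q^ a ⊛ f ≗ f ⊝ shift a f
1-q^-⊛ a f n = begin
  (1-q^ a ⊛ f) n                     ≡⟨ ⊛-distribʳ-⊝ 𝟙 (q^ (+ a / 1)) f n ⟩
  ((𝟙 ⊛ f) ⊝ (q^ (+ a / 1) ⊛ f)) n   ≡⟨ ⊝-cong (⊛-identityˡ f) qᵃ⊛f n ⟩
  (f ⊝ shift a f) n                  ∎
  where
  open ≡-Reasoning
  qᵃ⊛f : q^ (+ a / 1) ⊛ f ≗ shift a f
  qᵃ⊛f m = begin
    (q^ (+ a / 1) ⊛ f) m  ≡⟨ ⊛-congʳ f (q^-shift a) m ⟩
    (shift a 𝟙 ⊛ f) m     ≡⟨ shift-⊛ a 𝟙 f m ⟩
    shift a (𝟙 ⊛ f) m     ≡⟨ shift-cong a (⊛-identityˡ f) m ⟩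
    shift a f m           ∎

-- For a left factor 1 - qᵃ, associativity reduces to distributivity and `shift-⊛`, without double
-- sums.
1-q^-assoc : ∀ a f g → (1-q^ a ⊛ f) ⊛ g ≗ 1-q^ a ⊛ (f ⊛ g)
1-q^-assoc a f g n = begin
  ((1-q^ a ⊛ f) ⊛ g) n              ≡⟨ ⊛-congʳ g (1-q^-⊛ a f) n ⟩
  ((f ⊝ shift a f) ⊛ g) n           ≡⟨ ⊛-distribʳ-⊝ f (shift a f) g n ⟩
  ((f ⊛ g) ⊝ (shift a f ⊛ g)) n     ≡⟨ ⊝-cong {f ⊛ g} (λ _ → refl) (shift-⊛ a f g) n ⟩
  ((f ⊛ g) ⊝ shift a (f ⊛ g)) n     ≡⟨ 1-q^-⊛ a (f ⊛ g) n ⟨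
  (1-q^ a ⊛ (f ⊛ g)) n              ∎
  where open ≡-Reasoning

-- Only the index n - a is compared, so the hypothesis can come from a strong induction.
shift-agree : ∀ a {f g n} → (∀ {m} → a ℕ.+ m ≡ n → f m ≡ g m) → shift a f n ≡ shift a g n
shift-agree zero                f≡g = f≡g refl
shift-agree (suc a) {n = zero}  f≡g = refl
shift-agree (suc a) {n = suc n} f≡g = shift-agree a (f≡g ∘ cong suc)

-- Strong induction: the coefficient of `f` at m is fixed by the product and by an earlier
-- coefficient of `f`, earlier because the exponent `suc a` is positive.
1-q^-cancel : ∀ a {f g} → 1-q^ (suc a) ⊛ f ≗ g ⊝ shift (suc a) g → f ≗ g
1-q^-cancel a {f} {g} eq n = below (suc n) n (ℕ.n<1+n n)
  where
  open ≡-Reasoning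
  split : ∀ x y → x ≡ (x ℤ.- y) ℤ.+ y
  split = ℤSolver.solve-∀
  below : ∀ b m → m ℕ.< b → f m ≡ g m
  below (suc b) m (s≤s m≤b) = begin
    f m
      ≡⟨ split (f m) (shift (suc a) f m) ⟩
    (f m ℤ.- shift (suc a) f m) ℤ.+ shift (suc a) f m
      ≡⟨ cong₂ ℤ._+_ (trans (sym (1-q^-⊛ (suc a) f m)) (eq m)) (shift-agree (suc a) earlier) ⟩
    (g m ℤ.- shift (suc a) g m) ℤ.+ shift (suc a) g m
      ≡⟨ split (g m) (shift (suc a) g m) ⟨
    g m ∎
    where
    earlier : ∀ {l} → suc a ℕ.+ l ≡ m → f l ≡ g l
    earlier {l} refl = below b l (ℕ.≤-trans (s≤s (ℕ.m≤n+m l a)) m≤b)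

-- Partitions into parts 2, 3 and 5

-- The numbers of partitions into parts 2, into parts 2, 3 and into parts 2, 3, 5.
p₂ p₂₃ p₂₃₅ : ℕ → ℕ
p₂ 0 = 1
p₂ 1 = 0
p₂ (suc (suc n)) = p₂ n
p₂₃ 0 = 1
p₂₃ 1 = 0
p₂₃ 2 = 1
p₂₃ n@(suc (suc (suc m))) = p₂ n ℕ.+ p₂₃ m
p₂₃₅ 0 = 1
p₂₃₅ 1 = 0
p₂₃₅ 2 = 1
p₂₃₅ 3 = 1
p₂₃₅ 4 = 1
p₂₃₅ n@(suc (suc (suc (suc (suc m))))) = p₂₃ n ℕ.+ p₂₃₅ m

+-cancel : ∀ m n → + (m ℕ.+ n) ℤ.- + n ≡ + m
+-cancel m n rewrite ℤ.pos-+ m n = cancel (+ m) (+ n)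
  where
  cancel : ∀ x y → x ℤ.+ y ℤ.- y ≡ x
  cancel = ℤSolver.solve-∀

-- The factors are cancelled one at a time, 1 - q² first; the defining recursions of `p₂`, `p₂₃` and
-- `p₂₃₅` identify the quotient after each cancellation.
recip-235 : recip (1-q^ 2 ⊛ 1-q^ 3 ⊛ 1-q^ 5) ≗ +_ ∘ p₂₃₅
recip-235 = 1-q^-cancel 4 λ n → trans (step₂₃ n) (sym (Δp₂₃₅ n))
  where
  R = recip (1-q^ 2 ⊛ 1-q^ 3 ⊛ 1-q^ 5)
  Δp₂ : ∀ n → + p₂ n ℤ.- shift 2 (+_ ∘ p₂) n ≡ 𝟙 n
  Δp₂ 0 = refl
  Δp₂ 1 = refl
  Δp₂ (suc (suc n)) = ℤ.+-inverseʳ (+ p₂ n)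
  Δp₂₃ : ∀ n → + p₂₃ n ℤ.- shift 3 (+_ ∘ p₂₃) n ≡ + p₂ n
  Δp₂₃ 0 = refl
  Δp₂₃ 1 = refl
  Δp₂₃ 2 = refl
  Δp₂₃ n@(suc (suc (suc m))) = +-cancel (p₂ n) (p₂₃ m)
  Δp₂₃₅ : ∀ n → + p₂₃₅ n ℤ.- shift 5 (+_ ∘ p₂₃₅) n ≡ + p₂₃ n
  Δp₂₃₅ 0 = refl
  Δp₂₃₅ 1 = refl
  Δp₂₃₅ 2 = refl
  Δp₂₃₅ 3 = refl
  Δp₂₃₅ 4 = refl
  Δp₂₃₅ n@(suc (suc (suc (suc (suc m))))) = +-cancel (p₂₃ n) (p₂₃₅ m)
  step₁ : 1-q^ 2 ⊛ (1-q^ 3 ⊛ (1-q^ 5 ⊛ R)) ≗ 𝟙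
  step₁ n = begin
    (1-q^ 2 ⊛ (1-q^ 3 ⊛ (1-q^ 5 ⊛ R))) n ≡⟨ ⊛-congˡ (1-q^ 2) (1-q^-assoc 3 (1-q^ 5) R) n ⟨
    (1-q^ 2 ⊛ (1-q^ 3 ⊛ 1-q^ 5 ⊛ R)) n   ≡⟨ 1-q^-assoc 2 (1-q^ 3 ⊛ 1-q^ 5) R n ⟨
    (1-q^ 2 ⊛ (1-q^ 3 ⊛ 1-q^ 5) ⊛ R) n   ≡⟨ ⊛-congʳ R (1-q^-assoc 2 (1-q^ 3) (1-q^ 5)) n ⟨
    (1-q^ 2 ⊛ 1-q^ 3 ⊛ 1-q^ 5 ⊛ R) n     ≡⟨ ⊛-recip (1-q^ 2 ⊛ 1-q^ 3 ⊛ 1-q^ 5) refl n ⟩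
    𝟙 n                                  ∎
    where open ≡-Reasoning
  step₂ : 1-q^ 3 ⊛ (1-q^ 5 ⊛ R) ≗ +_ ∘ p₂
  step₂ = 1-q^-cancel 1 λ n → trans (step₁ n) (sym (Δp₂ n))
  step₂₃ : 1-q^ 5 ⊛ R ≗ +_ ∘ p₂₃
  step₂₃ = 1-q^-cancel 2 λ n → trans (step₂ n) (sym (Δp₂₃ n))

p₂-suc : ∀ n → p₂ n ℕ.+ p₂ (suc n) ≡ 1
p₂-suc 0 = refl
p₂-suc 1 = refl
p₂-suc (suc (suc n)) = p₂-suc n

-- Two steps of length 3 add `p₂` at arguments of opposite parity, exactly one of which contributes
-- 1.
p₂₃-6+ : ∀ n → p₂₃ (6 ℕ.+ n) ≡ suc (p₂₃ n)
p₂₃-6+ n = trans (sym (ℕ.+-assoc (p₂ n) (p₂ (suc n)) (p₂₃ n))) (cong (ℕ._+ p₂₃ n) (p₂-suc n))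

-- Sliding the window of six by one replaces `p₂₃ n` by `p₂₃ (6 + n)`, a gain of 1.
p₂₃-window : ∀ n → p₂₃ n ℕ.+ p₂₃ (1 ℕ.+ n) ℕ.+ p₂₃ (2 ℕ.+ n) ℕ.+ p₂₃ (3 ℕ.+ n)
                   ℕ.+ p₂₃ (4 ℕ.+ n) ℕ.+ p₂₃ (5 ℕ.+ n) ≡ n ℕ.+ 5
p₂₃-window zero    = refl
p₂₃-window (suc n) = trans
  (cong (λ y → p₂₃ (1 ℕ.+ n) ℕ.+ p₂₃ (2 ℕ.+ n) ℕ.+ p₂₃ (3 ℕ.+ n)
             ℕ.+ p₂₃ (4 ℕ.+ n) ℕ.+ p₂₃ (5 ℕ.+ n) ℕ.+ y) (p₂₃-6+ n))
  (trans (rotate (p₂₃ n) (p₂₃ (1 ℕ.+ n)) (p₂₃ (2 ℕ.+ n)) (p₂₃ (3 ℕ.+ n))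
                 (p₂₃ (4 ℕ.+ n)) (p₂₃ (5 ℕ.+ n)))
         (cong suc (p₂₃-window n)))
  where
  rotate : ∀ a b c d e f → b ℕ.+ c ℕ.+ d ℕ.+ e ℕ.+ f ℕ.+ (1 ℕ.+ a)
                         ≡ 1 ℕ.+ (a ℕ.+ b ℕ.+ c ℕ.+ d ℕ.+ e ℕ.+ f)
  rotate = ℕSolver.solve-∀

p₂₃-6*+ : ∀ i n → p₂₃ (i ℕ.* 6 ℕ.+ n) ≡ i ℕ.+ p₂₃ n
p₂₃-6*+ zero    n = refl
p₂₃-6*+ (suc i) n = trans (p₂₃-6+ (i ℕ.* 6 ℕ.+ n)) (cong suc (p₂₃-6*+ i n))

-- The six steps of length 5 meet every residue class modulo 6 once.
p₂₃₅-30+ : ∀ n → p₂₃₅ (30 ℕ.+ n) ≡ p₂₃₅ n ℕ.+ (n ℕ.+ 20)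
p₂₃₅-30+ n
  rewrite p₂₃-6*+ 5 n | p₂₃-6*+ 4 (1 ℕ.+ n) | p₂₃-6*+ 3 (2 ℕ.+ n)
        | p₂₃-6*+ 2 (3 ℕ.+ n) | p₂₃-6*+ 1 (4 ℕ.+ n)
  -- Reducing the six arguments to n, ..., n + 5 costs 5 + 4 + 3 + 2 + 1 = 15 periods of length 6.
  = trans (regroup (p₂₃ n) (p₂₃ (1 ℕ.+ n)) (p₂₃ (2 ℕ.+ n)) (p₂₃ (3 ℕ.+ n))
                   (p₂₃ (4 ℕ.+ n)) (p₂₃ (5 ℕ.+ n)) (p₂₃₅ n))
    (trans (cong (λ y → p₂₃₅ n ℕ.+ (y ℕ.+ 15)) (p₂₃-window n))
           (cong (p₂₃₅ n ℕ.+_) (ℕ.+-assoc n 5 15)))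
  where
  regroup : ∀ a b c d e f p →
    5 ℕ.+ a ℕ.+ (4 ℕ.+ b ℕ.+ (3 ℕ.+ c ℕ.+ (2 ℕ.+ d ℕ.+ (1 ℕ.+ e ℕ.+ (f ℕ.+ p)))))
    ≡ p ℕ.+ (a ℕ.+ b ℕ.+ c ℕ.+ d ℕ.+ e ℕ.+ f ℕ.+ 15)
  regroup = ℕSolver.solve-∀

-- Sums the increments of `p₂₃₅-30+` at r, r + 30, ..., r + 30(q - 1).
p₂₃₅-quasi : ∀ q r → p₂₃₅ (q ℕ.* 30 ℕ.+ r) ≡ p₂₃₅ r ℕ.+ (q ℕ.* (r ℕ.+ 5) ℕ.+ 15 ℕ.* (q ℕ.* q))
p₂₃₅-quasi zero    r = sym (ℕ.+-identityʳ (p₂₃₅ r))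
p₂₃₅-quasi (suc q) r = trans (p₂₃₅-30+ (q ℕ.* 30 ℕ.+ r))
  (trans (cong (ℕ._+ (q ℕ.* 30 ℕ.+ r ℕ.+ 20)) (p₂₃₅-quasi q r)) (collect (p₂₃₅ r) q r))
  where
  collect : ∀ p q r → p ℕ.+ (q ℕ.* (r ℕ.+ 5) ℕ.+ 15 ℕ.* (q ℕ.* q)) ℕ.+ (q ℕ.* 30 ℕ.+ r ℕ.+ 20)
                    ≡ p ℕ.+ ((1 ℕ.+ q) ℕ.* (r ℕ.+ 5) ℕ.+ 15 ℕ.* ((1 ℕ.+ q) ℕ.* (1 ℕ.+ q)))
  collect = ℕSolver.solve-∀

divMod-30 : ∀ n → n ≡ n ℕ./ 30 ℕ.* 30 ℕ.+ n % 30
divMod-30 n = trans (ℕ.m≡m%n+[m/n]*n n 30) (ℕ.+-comm (n % 30) (n ℕ./ 30 ℕ.* 30))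

-- Evaluates `p₂₃₅` only below 30, which keeps the finite computation cheap.
p₂₃₅-closed : ℕ → ℕ
p₂₃₅-closed n = p₂₃₅ r ℕ.+ (q ℕ.* (r ℕ.+ 5) ℕ.+ 15 ℕ.* (q ℕ.* q))
  where
  q = n ℕ./ 30
  r = n % 30

p₂₃₅≡closed : ∀ n → p₂₃₅ n ≡ p₂₃₅-closed n
p₂₃₅≡closed n = trans (cong p₂₃₅ (divMod-30 n)) (p₂₃₅-quasi (n ℕ./ 30) (n % 30))

-- 60 p₂₃₅ n − (n + 5)² depends only on n modulo 30.
ν : ℤ → ℤ → ℤ
ν x p = + 60 ℤ.* p ℤ.- (x ℤ.+ + 5) ℤ.* (x ℤ.+ + 5)

-- With x = 30q + r, both sides of the difference grow by 900q² + 60q(r + 5), which cancels.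
ν-periodic : ∀ q r → ν (+ (q ℕ.* 30 ℕ.+ r)) (+ p₂₃₅ (q ℕ.* 30 ℕ.+ r)) ≡ ν (+ r) (+ p₂₃₅ r)
ν-periodic q r = trans
  (cong₂ ν (cong (ℤ._+ + r) (ℤ.pos-* q 30)) (trans (cong +_ (p₂₃₅-quasi q r))
    (cong₂ (λ x y → + p₂₃₅ r ℤ.+ (x ℤ.+ y)) (ℤ.pos-* q (r ℕ.+ 5))
      (trans (ℤ.pos-* 15 (q ℕ.* q)) (cong (+ 15 ℤ.*_) (ℤ.pos-* q q))))))
  (expand (+ q) (+ r) (+ p₂₃₅ r))
  where
  expand : ∀ q r p →
    + 60 ℤ.* (p ℤ.+ (q ℤ.* (r ℤ.+ + 5) ℤ.+ + 15 ℤ.* (q ℤ.* q)))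
      ℤ.- (q ℤ.* + 30 ℤ.+ r ℤ.+ + 5) ℤ.* (q ℤ.* + 30 ℤ.+ r ℤ.+ + 5)
    ≡ + 60 ℤ.* p ℤ.- (r ℤ.+ + 5) ℤ.* (r ℤ.+ + 5)
  expand = ℤSolver.solve-∀

-- By periodicity the thirty residues suffice, and these are decided by evaluation. The value -36 is
-- attained at n = 1.
∣ν∣≤36 : ∀ n → 0ℤ ℤ.≤ + 36 ℤ.- ν (+ n) (+ p₂₃₅ n) × 0ℤ ℤ.≤ + 36 ℤ.+ ν (+ n) (+ p₂₃₅ n)
∣ν∣≤36 n = subst (λ m → Bounded (ν (+ m) (+ p₂₃₅ m))) (sym (divMod-30 n))
  (subst Bounded (sym (ν-periodic (n ℕ./ 30) (n % 30)))
    (from-yes (ℕ.allUpTo? (λ r → (0ℤ ℤ.≤? + 36 ℤ.- ν (+ r) (+ p₂₃₅ r)) ×-dec (0ℤ ℤ.≤? + 36 ℤ.+ ν (+ r) (+ p₂₃₅ r))) 30)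
      (ℕ.m%n<n n 30)))
  where
  Bounded : ℤ → Set
  Bounded x = 0ℤ ℤ.≤ + 36 ℤ.- x × 0ℤ ℤ.≤ + 36 ℤ.+ x

-- Tail sums

-- The exponent k(5k + 1)/2 as a sum of its gaps, which avoids halving and makes the gap 5k + 3
-- definitional.
pent : ℕ → ℕ
pent zero    = 0
pent (suc k) = pent k ℕ.+ (5 ℕ.* k ℕ.+ 3)

pent-double : ∀ k → + 2 ℤ.* + pent k ≡ + k ℤ.* (+ 5 ℤ.* + k ℤ.+ 1ℤ)
pent-double zero    = refl
pent-double (suc k) = begin
  + 2 ℤ.* (+ pent k ℤ.+ (+ (5 ℕ.* k) ℤ.+ + 3))            ≡⟨ cong (λ x → + 2 ℤ.* (+ pent k ℤ.+ (x ℤ.+ + 3))) (ℤ.pos-* 5 k) ⟩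
  + 2 ℤ.* (+ pent k ℤ.+ (+ 5 ℤ.* + k ℤ.+ + 3))            ≡⟨ ℤ.*-distribˡ-+ (+ 2) (+ pent k) (+ 5 ℤ.* + k ℤ.+ + 3) ⟩
  + 2 ℤ.* + pent k ℤ.+ + 2 ℤ.* (+ 5 ℤ.* + k ℤ.+ + 3)      ≡⟨ cong (ℤ._+ + 2 ℤ.* (+ 5 ℤ.* + k ℤ.+ + 3)) (pent-double k) ⟩
  + k ℤ.* (+ 5 ℤ.* + k ℤ.+ 1ℤ) ℤ.+ + 2 ℤ.* (+ 5 ℤ.* + k ℤ.+ + 3) ≡⟨ expand (+ k) ⟩
  (1ℤ ℤ.+ + k) ℤ.* (+ 5 ℤ.* (1ℤ ℤ.+ + k) ℤ.+ 1ℤ)          ∎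
  where
  open ≡-Reasoning
  expand : ∀ k → k ℤ.* (+ 5 ℤ.* k ℤ.+ 1ℤ) ℤ.+ + 2 ℤ.* (+ 5 ℤ.* k ℤ.+ + 3)
               ≡ (1ℤ ℤ.+ k) ℤ.* (+ 5 ℤ.* (1ℤ ℤ.+ k) ℤ.+ 1ℤ)
  expand = ℤSolver.solve-∀

5/2 1/2 : ℚᵘ
5/2 = + 5 / 2
1/2 = + 1 / 2

exponent-pos : ∀ j → exponent 5/2 1/2 (+ j) ≃ + pent j / 1
-- The unnormalised sum of two fractions over 2 has denominator 4, hence the factors 2 and 4.
exponent-pos j = *≡* (trans (expand (+ j)) (trans (cong (ℤ._* + 2) (sym (pent-double j))) (reorder (+ pent j))))
  where
  expand : ∀ j → (+ 5 ℤ.* (j ℤ.* j) ℤ.* + 2 ℤ.+ 1ℤ ℤ.* j ℤ.* + 2) ℤ.* 1ℤ ≡ j ℤ.* (+ 5 ℤ.* j ℤ.+ 1ℤ) ℤ.* + 2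
  expand = ℤSolver.solve-∀
  reorder : ∀ e → + 2 ℤ.* e ℤ.* + 2 ≡ e ℤ.* + 4
  reorder = ℤSolver.solve-∀

exponent-neg : ∀ j → exponent 5/2 1/2 (ℤ.- + suc j) ≃ + (pent j ℕ.+ (4 ℕ.* j ℕ.+ 2)) / 1
exponent-neg j = *≡* (trans (expand (+ j)) (trans (cong (λ e → (e ℤ.+ (+ 8 ℤ.* + j ℤ.+ + 4)) ℤ.* + 2) (sym (pent-double j)))
   (trans (reorder (+ pent j) (+ j)) (cong (λ x → (+ pent j ℤ.+ (x ℤ.+ + 2)) ℤ.* + 4) (sym (ℤ.pos-* 4 j))))))
  where
  expand : ∀ j → (+ 5 ℤ.* (ℤ.- (1ℤ ℤ.+ j) ℤ.* ℤ.- (1ℤ ℤ.+ j)) ℤ.* + 2 ℤ.+ 1ℤ ℤ.* ℤ.- (1ℤ ℤ.+ j) ℤ.* + 2) ℤ.* 1ℤ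
               ≡ (j ℤ.* (+ 5 ℤ.* j ℤ.+ 1ℤ) ℤ.+ (+ 8 ℤ.* j ℤ.+ + 4)) ℤ.* + 2
  expand = ℤSolver.solve-∀
  reorder : ∀ e j → (+ 2 ℤ.* e ℤ.+ (+ 8 ℤ.* j ℤ.+ + 4)) ℤ.* + 2 ≡ (e ℤ.+ (+ 4 ℤ.* j ℤ.+ + 2)) ℤ.* + 4
  reorder = ℤSolver.solve-∀

-- The powers of q for the indices j and -j - 1, whose signs are opposite.
pair : ℕ → Series
pair j = shift (pent j) 𝟙 ⊝ shift (pent j ℕ.+ (4 ℕ.* j ℕ.+ 2)) 𝟙

-- At j = k + i the sign exponent j + k is 2k + i, so the sign depends on i alone.
-1^-double : ∀ k i → -1ℤ ℤ.^ (k ℕ.+ i ℕ.+ k) ≡ -1ℤ ℤ.^ i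
-1^-double zero    i = cong (-1ℤ ℤ.^_) (ℕ.+-identityʳ i)
-1^-double (suc k) i = begin
  -1ℤ ℤ.* -1ℤ ℤ.^ (k ℕ.+ i ℕ.+ suc k)       ≡⟨ cong (λ m → -1ℤ ℤ.* -1ℤ ℤ.^ m) (ℕ.+-suc (k ℕ.+ i) k) ⟩
  -1ℤ ℤ.* (-1ℤ ℤ.* -1ℤ ℤ.^ (k ℕ.+ i ℕ.+ k)) ≡⟨ cancel (-1ℤ ℤ.^ (k ℕ.+ i ℕ.+ k)) ⟩
  -1ℤ ℤ.^ (k ℕ.+ i ℕ.+ k)                   ≡⟨ -1^-double k i ⟩
  -1ℤ ℤ.^ i                                 ∎
  where
  open ≡-Reasoning
  cancel : ∀ x → -1ℤ ℤ.* (-1ℤ ℤ.* x) ≡ x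
  cancel = ℤSolver.solve-∀

∣-suc+∣ : ∀ k i → ∣ (ℤ.- + (suc k ℕ.+ i)) ℤ.+ + k ∣ ≡ suc i
∣-suc+∣ k i = trans (cong ∣_∣ (trans (cong (λ x → ℤ.- (1ℤ ℤ.+ x) ℤ.+ + k) (ℤ.pos-+ k i)) (cancel (+ k) (+ i))))
  (ℤ.∣-i∣≡∣i∣ (+ suc i))
  where
  cancel : ∀ k i → ℤ.- (1ℤ ℤ.+ (k ℤ.+ i)) ℤ.+ k ≡ ℤ.- (1ℤ ℤ.+ i)
  cancel = ℤSolver.solve-∀

term-pair : ∀ k i n → term 5/2 1/2 k (+ (k ℕ.+ i)) n ℤ.+ term 5/2 1/2 k (ℤ.- + (suc k ℕ.+ i)) n
                    ≡ -1ℤ ℤ.^ i ℤ.* pair (k ℕ.+ i) n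
term-pair k i n = trans
  (cong₂ ℤ._+_
    (cong₂ ℤ._*_ (-1^-double k i)
      (trans (q^-cong (exponent-pos (k ℕ.+ i)) n) (q^-shift (pent (k ℕ.+ i)) n)))
    (cong₂ ℤ._*_ (cong (-1ℤ ℤ.^_) (∣-suc+∣ k i))
      (trans (q^-cong (exponent-neg (k ℕ.+ i)) n) (q^-shift (pent (k ℕ.+ i) ℕ.+ (4 ℕ.* (k ℕ.+ i) ℕ.+ 2)) n))))
  (collect (-1ℤ ℤ.^ i) _ _)
  where
  collect : ∀ s x y → s ℤ.* x ℤ.+ -1ℤ ℤ.* s ℤ.* y ≡ s ℤ.* (x ℤ.- y)
  collect = ℤSolver.solve-∀

tail-sum-pairs : ∀ k n → tail-sum 5/2 1/2 k n
  ≡ ∑[ i ≤ cutoff 5/2 1/2 n ] (-1ℤ ℤ.^ toℕ i ℤ.* pair (k ℕ.+ toℕ i) n)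
tail-sum-pairs k n = sum-cong-≗ {suc (cutoff 5/2 1/2 n)} (λ i → term-pair k (toℕ i) n)

pent-mono : ∀ k i → pent k ℕ.≤ pent (k ℕ.+ i)
pent-mono k zero    rewrite ℕ.+-identityʳ k = ℕ.≤-refl
pent-mono k (suc i) rewrite ℕ.+-suc k i = ℕ.≤-trans (pent-mono k i) (ℕ.m≤m+n (pent (k ℕ.+ i)) _)

n≤pent : ∀ n → n ℕ.≤ pent n
n≤pent zero    = z≤n
n≤pent (suc n) = ℕ.≤-trans (ℕ.+-mono-≤ {1} (s≤s z≤n) (n≤pent n))
  (ℕ.≤-trans (ℕ.≤-reflexive (ℕ.+-comm 1 (pent n)))
    (ℕ.+-monoʳ-≤ (pent n) (ℕ.≤-trans (s≤s z≤n) (ℕ.m≤n+m 3 (5 ℕ.* n)))))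

pair-< : ∀ j {n} → n ℕ.< pent j → pair j n ≡ 0ℤ
pair-< j n<e = cong₂ ℤ._-_ (shift-< 𝟙 n<e) (shift-< 𝟙 (ℕ.<-≤-trans n<e (ℕ.m≤m+n (pent j) _)))

tail-sum-< : ∀ k {n} → n ℕ.< pent k → tail-sum 5/2 1/2 k n ≡ 0ℤ
tail-sum-< k {n} n<e = trans (tail-sum-pairs k n)
  (sum-zero {suc (cutoff 5/2 1/2 n)} λ i → trans (cong (-1ℤ ℤ.^ toℕ i ℤ.*_) (pair-< (k ℕ.+ toℕ i) (ℕ.<-≤-trans n<e (pent-mono k (toℕ i)))))
                     (ℤ.*-zeroʳ (-1ℤ ℤ.^ toℕ i)))

-- Telescoping: each later summand of the first sum cancels one of the second. The induction peels
-- off both heads and negates the tails, which are sums of the same kind for `v ∘ suc`.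
alternating-sum : ∀ (v : ℕ → ℤ) N →
  (∑[ i ≤ N ] (-1ℤ ℤ.^ toℕ i ℤ.* v (toℕ i))) ℤ.+ (∑[ i ≤ N ] (-1ℤ ℤ.^ toℕ i ℤ.* v (suc (toℕ i))))
  ≡ v 0 ℤ.+ -1ℤ ℤ.^ N ℤ.* v (suc N)
alternating-sum v zero    = expand (v 0) (v 1)
  where
  expand : ∀ x y → (1ℤ ℤ.* x ℤ.+ 0ℤ) ℤ.+ (1ℤ ℤ.* y ℤ.+ 0ℤ) ≡ x ℤ.+ 1ℤ ℤ.* y
  expand = ℤSolver.solve-∀
alternating-sum v (suc N) = begin
  (1ℤ ℤ.* v 0 ℤ.+ sum (next v)) ℤ.+ (1ℤ ℤ.* v 1 ℤ.+ sum (next (v ∘ suc)))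
    ≡⟨ cong₂ (λ x y → (1ℤ ℤ.* v 0 ℤ.+ x) ℤ.+ (1ℤ ℤ.* v 1 ℤ.+ y)) (flip v) (flip (v ∘ suc)) ⟩
  (1ℤ ℤ.* v 0 ℤ.+ ℤ.- S) ℤ.+ (1ℤ ℤ.* v 1 ℤ.+ ℤ.- S′)
    ≡⟨ collect (v 0) (v 1) S S′ ⟩
  v 0 ℤ.+ v 1 ℤ.- (S ℤ.+ S′)
    ≡⟨ cong (λ x → v 0 ℤ.+ v 1 ℤ.- x) (alternating-sum (v ∘ suc) N) ⟩
  v 0 ℤ.+ v 1 ℤ.- (v 1 ℤ.+ -1ℤ ℤ.^ N ℤ.* v (suc (suc N)))
    ≡⟨ cancel (v 0) (v 1) (-1ℤ ℤ.^ N) (v (suc (suc N))) ⟩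
  v 0 ℤ.+ -1ℤ ℤ.* -1ℤ ℤ.^ N ℤ.* v (suc (suc N)) ∎
  where
  open ≡-Reasoning
  next : (ℕ → ℤ) → Fin (suc N) → ℤ
  next u i = -1ℤ ℤ.* -1ℤ ℤ.^ toℕ i ℤ.* u (suc (toℕ i))
  S  = ∑[ i ≤ N ] (-1ℤ ℤ.^ toℕ i ℤ.* v (suc (toℕ i)))
  S′ = ∑[ i ≤ N ] (-1ℤ ℤ.^ toℕ i ℤ.* v (suc (suc (toℕ i))))
  flip : ∀ u → sum (next u) ≡ ℤ.- (∑[ i ≤ N ] (-1ℤ ℤ.^ toℕ i ℤ.* u (suc (toℕ i))))
  flip u = trans (sum-cong-≗ {suc N} λ i → negate (-1ℤ ℤ.^ toℕ i) (u (suc (toℕ i))))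
                 (sum-neg {suc N} (λ i → -1ℤ ℤ.^ toℕ i ℤ.* u (suc (toℕ i))))
    where
    negate : ∀ s x → -1ℤ ℤ.* s ℤ.* x ≡ ℤ.- (s ℤ.* x)
    negate = ℤSolver.solve-∀
  collect : ∀ x y s t → (1ℤ ℤ.* x ℤ.+ ℤ.- s) ℤ.+ (1ℤ ℤ.* y ℤ.+ ℤ.- t) ≡ x ℤ.+ y ℤ.- (s ℤ.+ t)
  collect = ℤSolver.solve-∀
  cancel : ∀ x y s z → x ℤ.+ y ℤ.- (y ℤ.+ s ℤ.* z) ≡ x ℤ.+ -1ℤ ℤ.* s ℤ.* z
  cancel = ℤSolver.solve-∀

-- The cutoff does not depend on k, so both sums have equally many terms and telescope; the boundary
-- term vanishes because its exponents exceed n.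
tail-sum-step : ∀ k n → tail-sum 5/2 1/2 k n ℤ.+ tail-sum 5/2 1/2 (suc k) n ≡ pair k n
tail-sum-step k n = begin
  tail-sum 5/2 1/2 k n ℤ.+ tail-sum 5/2 1/2 (suc k) n
    ≡⟨ cong₂ ℤ._+_ (tail-sum-pairs k n) (trans (tail-sum-pairs (suc k) n)
         (sum-cong-≗ {suc N} λ i → cong (λ j → -1ℤ ℤ.^ toℕ i ℤ.* pair j n) (sym (ℕ.+-suc k (toℕ i))))) ⟩
  (∑[ i ≤ N ] (-1ℤ ℤ.^ toℕ i ℤ.* v (toℕ i))) ℤ.+ (∑[ i ≤ N ] (-1ℤ ℤ.^ toℕ i ℤ.* v (suc (toℕ i))))
    ≡⟨ alternating-sum v N ⟩
  v 0 ℤ.+ -1ℤ ℤ.^ N ℤ.* v (suc N)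
    ≡⟨ cong₂ (λ j x → pair j n ℤ.+ -1ℤ ℤ.^ N ℤ.* x) (ℕ.+-identityʳ k) (pair-< (k ℕ.+ suc N) n<) ⟩
  pair k n ℤ.+ -1ℤ ℤ.^ N ℤ.* 0ℤ
    ≡⟨ cong (λ x → pair k n ℤ.+ x) (ℤ.*-zeroʳ (-1ℤ ℤ.^ N)) ⟩
  pair k n ℤ.+ 0ℤ
    ≡⟨ ℤ.+-identityʳ (pair k n) ⟩
  pair k n ∎
  where
  open ≡-Reasoning
  N = cutoff 5/2 1/2 n
  v : ℕ → ℤ
  v i = pair (k ℕ.+ i) n
  n< : n ℕ.< pent (k ℕ.+ suc N)
  n< = ℕ.≤-trans (s≤s (ℕ.m≤m+n n _)) (ℕ.≤-trans (ℕ.m≤n+m (suc N) k) (n≤pent (k ℕ.+ suc N)))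

-- Recursion for the coefficients

Γ : ℕ → Series
Γ k X = γ 2 3 5 5/2 1/2 k (pent k ℕ.+ X)

γ-< : ∀ k {n} → n ℕ.< pent k → γ 2 3 5 5/2 1/2 k n ≡ 0ℤ
γ-< k {n} n<e = sum-zero {suc n} λ i → trans
  (cong (recip (1-q^ 2 ⊛ 1-q^ 3 ⊛ 1-q^ 5) (toℕ i) ℤ.*_) (tail-sum-< k (ℕ.≤-<-trans (ℕ.m∸n≤m n (toℕ i)) n<e)))
  (ℤ.*-zeroʳ (recip (1-q^ 2 ⊛ 1-q^ 3 ⊛ 1-q^ 5) (toℕ i)))

γ-step : ∀ k n → γ 2 3 5 5/2 1/2 k n ℤ.+ γ 2 3 5 5/2 1/2 (suc k) n
  ≡ shift (pent k) (+_ ∘ p₂₃₅) n ℤ.- shift (pent k ℕ.+ (4 ℕ.* k ℕ.+ 2)) (+_ ∘ p₂₃₅) n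
γ-step k n = begin
  (R ⊛ tail-sum 5/2 1/2 k) n ℤ.+ (R ⊛ tail-sum 5/2 1/2 (suc k)) n
    ≡⟨ ⊛-distribˡ-+ R (tail-sum 5/2 1/2 k) (tail-sum 5/2 1/2 (suc k)) n ⟩
  (R ⊛ (λ m → tail-sum 5/2 1/2 k m ℤ.+ tail-sum 5/2 1/2 (suc k) m)) n
    ≡⟨ ⊛-congˡ R (tail-sum-step k) n ⟩
  (R ⊛ pair k) n
    ≡⟨ ⊛-distribˡ-⊝ R (shift a 𝟙) (shift b 𝟙) n ⟩
  (R ⊛ shift a 𝟙) n ℤ.- (R ⊛ shift b 𝟙) n
    ≡⟨ cong₂ ℤ._-_ (R⊛ a) (R⊛ b) ⟩
  shift a (+_ ∘ p₂₃₅) n ℤ.- shift b (+_ ∘ p₂₃₅) n ∎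
  where
  open ≡-Reasoning
  a = pent k
  b = pent k ℕ.+ (4 ℕ.* k ℕ.+ 2)
  R = recip (1-q^ 2 ⊛ 1-q^ 3 ⊛ 1-q^ 5)
  R⊛ : ∀ c → (R ⊛ shift c 𝟙) n ≡ shift c (+_ ∘ p₂₃₅) n
  R⊛ c = trans (⊛-shift c R 𝟙 n) (shift-cong c (λ m → trans (⊛-identityʳ R m) (recip-235 m)) n)

shift-+-+ : ∀ a b f n → shift (a ℕ.+ b) f (a ℕ.+ n) ≡ shift b f n
shift-+-+ zero    b f n = refl
shift-+-+ (suc a) b f n = shift-+-+ a b f n

Γ-unfold : ∀ k X → Γ k X ≡ + p₂₃₅ X ℤ.- shift (4 ℕ.* k ℕ.+ 2) (+_ ∘ p₂₃₅) X ℤ.- shift (5 ℕ.* k ℕ.+ 3) (Γ (suc k)) X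
Γ-unfold k X = trans (isolate (Γ k X) _ _ (γ-step k (pent k ℕ.+ X)))
  (cong₂ ℤ._-_ (cong₂ ℤ._-_ (shift-+ (pent k) _ X) (shift-+-+ (pent k) (4 ℕ.* k ℕ.+ 2) _ X)) next)
  where
  isolate : ∀ x y z → x ℤ.+ y ≡ z → x ≡ z ℤ.- y
  isolate x y z refl = sym (+-cancelʳ x y)
    where
    +-cancelʳ : ∀ x y → x ℤ.+ y ℤ.- y ≡ x
    +-cancelʳ = ℤSolver.solve-∀
  next : γ 2 3 5 5/2 1/2 (suc k) (pent k ℕ.+ X) ≡ shift (5 ℕ.* k ℕ.+ 3) (Γ (suc k)) X
  -- `pent (suc k)` is `pent k` plus 5k + 3: either the index lies below the first exponent of the
  -- next tail sum, or it exceeds that exponent by X - 5k - 3.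
  next with X ℕ.<? 5 ℕ.* k ℕ.+ 3
  ... | yes X< = trans (γ-< (suc k) (ℕ.+-monoʳ-< (pent k) X<)) (sym (shift-< (Γ (suc k)) X<))
  ... | no  X≮ with Y , refl ← ℕ.m≤n⇒∃[o]m+o≡n (ℕ.≮⇒≥ X≮)
    = trans (cong (γ 2 3 5 5/2 1/2 (suc k)) (sym (ℕ.+-assoc (pent k) (5 ℕ.* k ℕ.+ 3) Y)))
            (sym (shift-+ (5 ℕ.* k ℕ.+ 3) (Γ (suc k)) Y))

-- Bounds

-- 300 Γ k x is main k x up to an error of at most slack k x.  main solves
-- main k x + main (k + 1) (x − 5k − 3) = 5 ((x + 5)² − (x − 4k + 3)²), and slack
-- grows by 360 = 2 · 5 · 36 along the recursion, the error of two values of p₂₃₅.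
main slack : ℤ → ℤ → ℤ
main k x = + 20 ℤ.* k ℤ.* x ℤ.+ + 10 ℤ.* k ℤ.* k ℤ.+ + 130 ℤ.* k
slack k x = + 16 ℤ.* x ℤ.+ + 40 ℤ.* k ℤ.* k ℤ.- + 352 ℤ.* k ℤ.+ + 3850

infixl 8 _·_
_·_ : ∀ {n} → ℕ → Polynomial n → Polynomial n
c · x = con (+ c) :* x

-- Solver syntax for `ν`, `main` and `slack`.
‵ν ‵main ‵slack : ∀ {n} → Polynomial n → Polynomial n → Polynomial n
‵ν x p = 60 · p :- (x :+ con (+ 5)) :* (x :+ con (+ 5))
‵main k x = 20 · k :* x :+ 10 · k :* k :+ 130 · k
‵slack k x = 16 · x :+ 40 · k :* k :- 352 · k :+ con (+ 3850)


0≤pos : ∀ n → 0ℤ ℤ.≤ + n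
0≤pos n = +≤+ z≤n

0≤* : ∀ {a b} → 0ℤ ℤ.≤ a → 0ℤ ℤ.≤ b → 0ℤ ℤ.≤ a ℤ.* b
0≤* {+ m} {+ n} _ _ = subst (0ℤ ℤ.≤_) (ℤ.pos-* m n) (+≤+ z≤n)

0≤sq : ∀ a → 0ℤ ℤ.≤ a ℤ.* a
0≤sq (+ n)    = 0≤* (0≤pos n) (0≤pos n)
0≤sq -[1+ n ] = +≤+ z≤n

-- Combinators that let a nonnegativity proof follow the shape of its certificate term by term.
infixl 6 _⊞_
infixl 7 _⊠_
_⊞_ : ∀ {a b} → 0ℤ ℤ.≤ a → 0ℤ ℤ.≤ b → 0ℤ ℤ.≤ a ℤ.+ b
_⊞_ = ℤ.+-mono-≤
_⊠_ : ∀ {b} n → 0ℤ ℤ.≤ b → 0ℤ ℤ.≤ + n ℤ.* b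
n ⊠ b = 0≤* (0≤pos n) b

record Close (k X : ℕ) (g : ℤ) : Set where
  constructor close
  field
    upper : 0ℤ ℤ.≤ slack (+ k) (+ X) ℤ.- (+ 300 ℤ.* g ℤ.- main (+ k) (+ X))
    lower : 0ℤ ℤ.≤ slack (+ k) (+ X) ℤ.+ (+ 300 ℤ.* g ℤ.- main (+ k) (+ X))

-- The ranges differ in which subtracted terms of `Γ-unfold` are present: none, only the partition
-- number, or both.
data Region (k : ℕ) : ℕ → Set where
  small : ∀ {X} → X ℕ.≤ 4 ℕ.* k ℕ.+ 1 → Region k X
  mid   : ∀ {Z} → Z ℕ.≤ k → Region k (4 ℕ.* k ℕ.+ 2 ℕ.+ Z)
  large : ∀ {Y} → Region k (5 ℕ.* k ℕ.+ 3 ℕ.+ Y)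

5k+3≡ : ∀ k → 5 ℕ.* k ℕ.+ 3 ≡ 4 ℕ.* k ℕ.+ 2 ℕ.+ (1 ℕ.+ k)
5k+3≡ = ℕSolver.solve-∀

region : ∀ k X → Region k X
region k X with X ℕ.<? 4 ℕ.* k ℕ.+ 2
... | yes X< = small (ℕ.≤-pred (ℕ.≤-trans X< (ℕ.≤-reflexive (ℕ.+-suc (4 ℕ.* k) 1))))
... | no  X≮ with Z , refl ← ℕ.m≤n⇒∃[o]m+o≡n (ℕ.≮⇒≥ X≮) with Z ℕ.≤? k
...   | yes Z≤ = mid Z≤
...   | no  Z≰ with Y , refl ← ℕ.m≤n⇒∃[o]m+o≡n (ℕ.≰⇒> Z≰)
  = subst (Region k) (trans (cong (ℕ._+ Y) (5k+3≡ k)) (ℕ.+-assoc (4 ℕ.* k ℕ.+ 2) (suc k) Y)) large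

Γ-small : ∀ k {X} → X ℕ.≤ 4 ℕ.* k ℕ.+ 1 → Γ k X ≡ + p₂₃₅ X
Γ-small k {X} X≤ = trans (Γ-unfold k X)
  (trans (cong₂ (λ x y → + p₂₃₅ X ℤ.- x ℤ.- y) (shift-< _ X<) (shift-< _ (ℕ.<-≤-trans X< 4k+2≤)))
         (trans (ℤ.+-identityʳ (+ p₂₃₅ X ℤ.- 0ℤ)) (ℤ.+-identityʳ (+ p₂₃₅ X))))
  where
  X< : X ℕ.< 4 ℕ.* k ℕ.+ 2
  X< = ℕ.≤-trans (s≤s X≤) (ℕ.≤-reflexive (sym (ℕ.+-suc (4 ℕ.* k) 1)))
  4k+2≤ : 4 ℕ.* k ℕ.+ 2 ℕ.≤ 5 ℕ.* k ℕ.+ 3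
  4k+2≤ = ℕ.≤-trans (ℕ.m≤m+n _ (suc k)) (ℕ.≤-reflexive (sym (5k+3≡ k)))

Γ-mid : ∀ k {Z} → Z ℕ.≤ k → Γ k (4 ℕ.* k ℕ.+ 2 ℕ.+ Z) ≡ + p₂₃₅ (4 ℕ.* k ℕ.+ 2 ℕ.+ Z) ℤ.- + p₂₃₅ Z
Γ-mid k {Z} Z≤k = trans (Γ-unfold k X)
  (trans (cong₂ (λ x y → + p₂₃₅ X ℤ.- x ℤ.- y) (shift-+ (4 ℕ.* k ℕ.+ 2) _ Z) (shift-< (Γ (suc k)) X<))
         (ℤ.+-identityʳ (+ p₂₃₅ X ℤ.- + p₂₃₅ Z)))
  where
  X = 4 ℕ.* k ℕ.+ 2 ℕ.+ Z
  X< : X ℕ.< 5 ℕ.* k ℕ.+ 3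
  X< = ℕ.<-≤-trans (ℕ.+-monoʳ-< (4 ℕ.* k ℕ.+ 2) (s≤s Z≤k)) (ℕ.≤-reflexive (sym (5k+3≡ k)))

Γ-large : ∀ k Y → Γ k (5 ℕ.* k ℕ.+ 3 ℕ.+ Y) ≡ + p₂₃₅ (5 ℕ.* k ℕ.+ 3 ℕ.+ Y) ℤ.- + p₂₃₅ (suc k ℕ.+ Y) ℤ.- Γ (suc k) Y
Γ-large k Y = trans (Γ-unfold k X)
  (cong₂ (λ x y → + p₂₃₅ X ℤ.- x ℤ.- y)
    (trans (cong (shift (4 ℕ.* k ℕ.+ 2) _) X≡) (shift-+ (4 ℕ.* k ℕ.+ 2) _ (suc k ℕ.+ Y)))
    (shift-+ (5 ℕ.* k ℕ.+ 3) (Γ (suc k)) Y))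
  where
  X = 5 ℕ.* k ℕ.+ 3 ℕ.+ Y
  X≡ : X ≡ 4 ℕ.* k ℕ.+ 2 ℕ.+ (suc k ℕ.+ Y)
  X≡ = trans (cong (ℕ._+ Y) (5k+3≡ k)) (ℕ.+-assoc (4 ℕ.* k ℕ.+ 2) (suc k) Y)

0≤36-ν : ∀ n → 0ℤ ℤ.≤ + 36 ℤ.- ν (+ n) (+ p₂₃₅ n)
0≤36-ν n = proj₁ (∣ν∣≤36 n)

0≤36+ν : ∀ n → 0ℤ ℤ.≤ + 36 ℤ.+ ν (+ n) (+ p₂₃₅ n)
0≤36+ν n = proj₂ (∣ν∣≤36 n)

-- The bounds below are certified by ring identities that write the difference of
-- the two sides as a combination of squares and other nonnegative quantities.
close-small : ∀ k {X} → X ℕ.≤ 4 ℕ.* k ℕ.+ 1 → Close k X (+ p₂₃₅ X)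
close-small k {X} X≤ = close
  (subst (0ℤ ℤ.≤_)
    (solve 3 (λ k x p → let w = 4 · k :+ con 1ℤ :- x in
        5 · (con (+ 36) :- ‵ν x p) :+ 5 · (x :* w) :+ 39 · w
          :+ 50 · ((k :- con (+ 4)) :* (k :- con (+ 4))) :+ 22 · k :+ con (+ 2706)
      := ‵slack k x :- (300 · p :- ‵main k x)) refl (+ k) (+ X) (+ p₂₃₅ X))
    (5 ⊠ 0≤36-ν X ⊞ 5 ⊠ 0≤* (0≤pos X) 0≤w ⊞ 39 ⊠ 0≤w
      ⊞ 50 ⊠ 0≤sq (+ k ℤ.- + 4) ⊞ 22 ⊠ 0≤pos k ⊞ 0≤pos 2706))
  (subst (0ℤ ℤ.≤_)
    -- The square of y completes the square in x; the square of k - 19 does the same for the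
    -- remainder up to nonnegative linear terms.
    (solve 3 (λ k x p → let y = x :- 2 · k :+ con (+ 6) in
        5 · (con (+ 36) :+ ‵ν x p) :+ 5 · (y :* y) :+ 6 · x
          :+ 10 · ((k :- con (+ 19)) :* (k :- con (+ 19))) :+ 18 · k :+ con (+ 5)
      := ‵slack k x :+ (300 · p :- ‵main k x)) refl (+ k) (+ X) (+ p₂₃₅ X))
    (5 ⊠ 0≤36+ν X ⊞ 5 ⊠ 0≤sq (+ X ℤ.- + 2 ℤ.* + k ℤ.+ + 6) ⊞ 6 ⊠ 0≤pos X
      ⊞ 10 ⊠ 0≤sq (+ k ℤ.- + 19) ⊞ 18 ⊠ 0≤pos k ⊞ 0≤pos 5))
  where
  0≤w : 0ℤ ℤ.≤ + 4 ℤ.* + k ℤ.+ 1ℤ ℤ.- + X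
  0≤w = subst (λ x → 0ℤ ℤ.≤ x ℤ.+ 1ℤ ℤ.- + X) (ℤ.pos-* 4 k) (ℤ.i≤j⇒0≤j-i (+≤+ X≤))

+⟨c*k+d+n⟩ : ∀ c k d n → + (c ℕ.* k ℕ.+ d ℕ.+ n) ≡ + c ℤ.* + k ℤ.+ + d ℤ.+ + n
+⟨c*k+d+n⟩ c k d n = cong (λ x → x ℤ.+ + d ℤ.+ + n) (ℤ.pos-* c k)

close-mid : ∀ k {Z} → Z ℕ.≤ k → let X = 4 ℕ.* k ℕ.+ 2 ℕ.+ Z in Close k X (+ p₂₃₅ X ℤ.- + p₂₃₅ Z)
close-mid k {Z} Z≤k = uncurry close (bounds (+⟨c*k+d+n⟩ 4 k 2 Z) (0≤36-ν X) (0≤36+ν X))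
  where
  X = 4 ℕ.* k ℕ.+ 2 ℕ.+ Z
  0≤w : 0ℤ ℤ.≤ + k ℤ.- + Z
  0≤w = ℤ.i≤j⇒0≤j-i (+≤+ Z≤k)
  -- Abstracting `+ X` to x lets `refl` replace it by a polynomial in k and Z, while `p₂₃₅ X` stays
  -- an atom for the solver.
  bounds : ∀ {x} → x ≡ + 4 ℤ.* + k ℤ.+ + 2 ℤ.+ + Z →
    0ℤ ℤ.≤ + 36 ℤ.- ν x (+ p₂₃₅ X) → 0ℤ ℤ.≤ + 36 ℤ.+ ν x (+ p₂₃₅ X) →
      0ℤ ℤ.≤ slack (+ k) x ℤ.- (+ 300 ℤ.* (+ p₂₃₅ X ℤ.- + p₂₃₅ Z) ℤ.- main (+ k) x)
    × 0ℤ ℤ.≤ slack (+ k) x ℤ.+ (+ 300 ℤ.* (+ p₂₃₅ X ℤ.- + p₂₃₅ Z) ℤ.- main (+ k) x)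
  bounds refl 36-ν 36+ν =
    subst (0ℤ ℤ.≤_)
      (solve 4 (λ k z p p′ → let x = 4 · k :+ con (+ 2) :+ z; w = k :- z in
          5 · (con (+ 36) :- ‵ν x p) :+ 5 · (con (+ 36) :+ ‵ν z p′) :+ 20 · (k :* w) :+ 4 · w
            :+ 30 · ((k :- con (+ 7)) :* (k :- con (+ 7))) :+ 18 · k :+ con (+ 1932)
        := ‵slack k x :- (300 · (p :- p′) :- ‵main k x)) refl (+ k) (+ Z) (+ p₂₃₅ X) (+ p₂₃₅ Z))
      (5 ⊠ 36-ν ⊞ 5 ⊠ 0≤36+ν Z ⊞ 20 ⊠ 0≤* (0≤pos k) 0≤w ⊞ 4 ⊠ 0≤w
        ⊞ 30 ⊠ 0≤sq (+ k ℤ.- + 7) ⊞ 18 ⊠ 0≤pos k ⊞ 0≤pos 1932)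
    ,
    subst (0ℤ ℤ.≤_)
      (solve 4 (λ k z p p′ → let x = 4 · k :+ con (+ 2) :+ z in
          5 · (con (+ 36) :+ ‵ν x p) :+ 5 · (con (+ 36) :- ‵ν z p′) :+ 20 · (k :* z) :+ 36 · z
            :+ 30 · ((k :- con (+ 4)) :* (k :- con (+ 4))) :+ 62 · k :+ con (+ 3162)
        := ‵slack k x :+ (300 · (p :- p′) :- ‵main k x)) refl (+ k) (+ Z) (+ p₂₃₅ X) (+ p₂₃₅ Z))
      (5 ⊠ 36+ν ⊞ 5 ⊠ 0≤36-ν Z ⊞ 20 ⊠ 0≤* (0≤pos k) (0≤pos Z) ⊞ 36 ⊠ 0≤pos Z
        ⊞ 30 ⊠ 0≤sq (+ k ℤ.- + 4) ⊞ 62 ⊠ 0≤pos k ⊞ 0≤pos 3162)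

-- `g` enters with a minus sign, so its lower bound gives the upper bound and conversely; the main
-- terms cancel and the growth of the slack absorbs both partition errors.
close-large : ∀ k Y {g} → Close (suc k) Y g → let X = 5 ℕ.* k ℕ.+ 3 ℕ.+ Y in
              Close k X (+ p₂₃₅ X ℤ.- + p₂₃₅ (suc k ℕ.+ Y) ℤ.- g)
close-large k Y {g} (close upper lower) = uncurry close (bounds (+⟨c*k+d+n⟩ 5 k 3 Y) (0≤36-ν X) (0≤36+ν X))
  where
  X = 5 ℕ.* k ℕ.+ 3 ℕ.+ Y
  Z = suc k ℕ.+ Y
  bounds : ∀ {x} → x ≡ + 5 ℤ.* + k ℤ.+ + 3 ℤ.+ + Y →
    0ℤ ℤ.≤ + 36 ℤ.- ν x (+ p₂₃₅ X) → 0ℤ ℤ.≤ + 36 ℤ.+ ν x (+ p₂₃₅ X) →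
      0ℤ ℤ.≤ slack (+ k) x ℤ.- (+ 300 ℤ.* (+ p₂₃₅ X ℤ.- + p₂₃₅ Z ℤ.- g) ℤ.- main (+ k) x)
    × 0ℤ ℤ.≤ slack (+ k) x ℤ.+ (+ 300 ℤ.* (+ p₂₃₅ X ℤ.- + p₂₃₅ Z ℤ.- g) ℤ.- main (+ k) x)
  bounds refl 36-ν 36+ν =
    subst (0ℤ ℤ.≤_)
      (solve 5 (λ k y p p′ g → let x = 5 · k :+ con (+ 3) :+ y; k′ = con 1ℤ :+ k in
          ‵slack k′ y :+ (300 · g :- ‵main k′ y)
            :+ 5 · (con (+ 36) :- ‵ν x p) :+ 5 · (con (+ 36) :+ ‵ν (k′ :+ y) p′)
        := ‵slack k x :- (300 · (p :- p′ :- g) :- ‵main k x)) refl (+ k) (+ Y) (+ p₂₃₅ X) (+ p₂₃₅ Z) g)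
      (lower ⊞ 5 ⊠ 36-ν ⊞ 5 ⊠ 0≤36+ν Z)
    ,
    subst (0ℤ ℤ.≤_)
      (solve 5 (λ k y p p′ g → let x = 5 · k :+ con (+ 3) :+ y; k′ = con 1ℤ :+ k in
          (‵slack k′ y :- (300 · g :- ‵main k′ y))
            :+ 5 · (con (+ 36) :+ ‵ν x p) :+ 5 · (con (+ 36) :- ‵ν (k′ :+ y) p′)
        := ‵slack k x :+ (300 · (p :- p′ :- g) :- ‵main k x)) refl (+ k) (+ Y) (+ p₂₃₅ X) (+ p₂₃₅ Z) g)
      (upper ⊞ 5 ⊠ 36+ν ⊞ 5 ⊠ 0≤36-ν Z)

-- Strong induction on X through the bound b, for all k at once, because the recursion raises k
-- while lowering X.
Γ-close : ∀ k X → Close k X (Γ k X)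
Γ-close k X = below (suc X) k X (ℕ.n<1+n X)
  where
  below : ∀ b k X → X ℕ.< b → Close k X (Γ k X)
  step : ∀ b k {X} → X ℕ.≤ b → Region k X → Close k X (Γ k X)
  below (suc b) k X (s≤s X≤b) = step b k X≤b (region k X)
  step b k X≤b (small X≤)    = subst (Close k _) (sym (Γ-small k X≤)) (close-small k X≤)
  step b k X≤b (mid Z≤k)     = subst (Close k _) (sym (Γ-mid k Z≤k)) (close-mid k Z≤k)
  step b k X≤b (large {Y})   = subst (Close k _) (sym (Γ-large k Y))
    (close-large k Y (below b (suc k) Y (ℕ.<-≤-trans Y< X≤b)))
    where
    Y< : Y ℕ.< 5 ℕ.* k ℕ.+ 3 ℕ.+ Y
    Y< = ℕ.+-monoˡ-≤ Y (ℕ.≤-trans (s≤s z≤n) (ℕ.m≤n+m 3 (5 ℕ.* k)))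

-- Positivity

close⇒0≤ : ∀ {k X g} → Close k X g → 0ℤ ℤ.≤ main (+ k) (+ X) ℤ.- slack (+ k) (+ X) → 0ℤ ℤ.≤ g
close⇒0≤ {k} {X} {g} (close _ lower) main≥slack = ℤ.*-cancelˡ-≤-pos 0ℤ g (+ 300)
  (subst (0ℤ ℤ.≤_) (cancel (main (+ k) (+ X)) (slack (+ k) (+ X)) (+ 300 ℤ.* g)) (lower ⊞ main≥slack))
  where
  cancel : ∀ m s g → (s ℤ.+ (g ℤ.- m)) ℤ.+ (m ℤ.- s) ≡ g
  cancel = ℤSolver.solve-∀

-- X is at least Z + 6, so the squares differ by at least 96, which exceeds the total error 2 · 36
-- by 24.
0≤p₂₃₅-difference : ∀ k Z → let X = 4 ℕ.* suc k ℕ.+ 2 ℕ.+ Z in 0ℤ ℤ.≤ + p₂₃₅ X ℤ.- + p₂₃₅ Z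
0≤p₂₃₅-difference k Z = bound (+⟨c*k+d+n⟩ 4 (suc k) 2 Z) (0≤36+ν X)
  where
  X = 4 ℕ.* suc k ℕ.+ 2 ℕ.+ Z
  bound : ∀ {x} → x ≡ + 4 ℤ.* + suc k ℤ.+ + 2 ℤ.+ + Z →
    0ℤ ℤ.≤ + 36 ℤ.+ ν x (+ p₂₃₅ X) → 0ℤ ℤ.≤ + p₂₃₅ X ℤ.- + p₂₃₅ Z
  bound refl 36+ν = ℤ.*-cancelˡ-≤-pos 0ℤ _ (+ 60) (subst (0ℤ ℤ.≤_)
    (solve 4 (λ j z p p′ → let x = 4 · (con 1ℤ :+ j) :+ con (+ 2) :+ z in
        (con (+ 36) :+ ‵ν x p) :+ (con (+ 36) :- ‵ν z p′)
          :+ con (+ 24) :+ 88 · j :+ 12 · z :+ 16 · (j :* j) :+ 8 · (j :* z)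
      := 60 · (p :- p′)) refl (+ k) (+ Z) (+ p₂₃₅ X) (+ p₂₃₅ Z))
    (36+ν ⊞ 0≤36-ν Z ⊞ 0≤pos 24 ⊞ 88 ⊠ 0≤pos k ⊞ 12 ⊠ 0≤pos Z ⊞ 16 ⊠ 0≤sq (+ k) ⊞ 8 ⊠ 0≤* (0≤pos k) (0≤pos Z)))

-- Five is the least k for which the main term wins from x = 5k + 3 on: the margin there is 162,
-- whereas k = 4 fails at x = 23.
slack≤main-5≤k : ∀ j Y → 0ℤ ℤ.≤ main (+ (5 ℕ.+ j)) (+ (5 ℕ.* (5 ℕ.+ j) ℕ.+ 3 ℕ.+ Y)) ℤ.- slack (+ (5 ℕ.+ j)) (+ (5 ℕ.* (5 ℕ.+ j) ℕ.+ 3 ℕ.+ Y))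
slack≤main-5≤k j Y rewrite +⟨c*k+d+n⟩ 5 (5 ℕ.+ j) 3 Y = subst (0ℤ ℤ.≤_)
  (solve 2 (λ j y → let k = con (+ 5) :+ j; x = 5 · k :+ con (+ 3) :+ y in
      con (+ 162) :+ 1162 · j :+ 70 · (j :* j) :+ 84 · y :+ 20 · (j :* y)
    := ‵main k x :- ‵slack k x) refl (+ j) (+ Y))
  (0≤pos 162 ⊞ 1162 ⊠ 0≤pos j ⊞ 70 ⊠ 0≤sq (+ j) ⊞ 84 ⊠ 0≤pos Y ⊞ 20 ⊠ 0≤* (0≤pos j) (0≤pos Y))

-- The threshold 850 comes from k = 1, where the margin is 4x - 3398.
slack≤main-k≤4 : ∀ {j} Y → j ℕ.≤ 3 → 0ℤ ℤ.≤ main (+ suc j) (+ (850 ℕ.+ Y)) ℤ.- slack (+ suc j) (+ (850 ℕ.+ Y))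
slack≤main-k≤4 {j} Y j≤3 = subst (0ℤ ℤ.≤_)
  (solve 2 (λ j y → let k = con 1ℤ :+ j; x = con (+ 850) :+ y in
      con (+ 2) :+ 17332 · j :+ 30 · (j :* (con (+ 3) :- j)) :+ 4 · y :+ 20 · (j :* y)
    := ‵main k x :- ‵slack k x) refl (+ j) (+ Y))
  (0≤pos 2 ⊞ 17332 ⊠ 0≤pos j ⊞ 30 ⊠ 0≤* (0≤pos j) (ℤ.i≤j⇒0≤j-i (+≤+ j≤3))
    ⊞ 4 ⊠ 0≤pos Y ⊞ 20 ⊠ 0≤* (0≤pos j) (0≤pos Y))

-- The recursion with fuel b, in a form that evaluates. The default 0 is never reached when X < b,
-- since each unfolding lowers X by at least 3.
Γ-approx : ℕ → ℕ → Series
Γ-approx zero    k X = 0ℤ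
Γ-approx (suc b) k X = + p₂₃₅-closed X ℤ.- shift (4 ℕ.* k ℕ.+ 2) (+_ ∘ p₂₃₅-closed) X
                       ℤ.- shift (5 ℕ.* k ℕ.+ 3) (Γ-approx b (suc k)) X

Γ≡approx : ∀ b k {X} → X ℕ.< b → Γ k X ≡ Γ-approx b k X
Γ≡approx (suc b) k {X} (s≤s X≤b) = trans (Γ-unfold k X)
  (cong₂ ℤ._-_ (cong₂ ℤ._-_ (closed X) (shift-cong (4 ℕ.* k ℕ.+ 2) closed X))
    (shift-agree (5 ℕ.* k ℕ.+ 3) λ { {m} refl → Γ≡approx b (suc k) (ℕ.<-≤-trans
       (ℕ.+-monoˡ-≤ m (ℕ.≤-trans (s≤s z≤n) (ℕ.m≤n+m 3 (5 ℕ.* k)))) X≤b) }))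
  where
  closed : ∀ n → + p₂₃₅ n ≡ + p₂₃₅-closed n
  closed n = cong +_ (p₂₃₅≡closed n)

0≤approx : ∀ {j} → j ℕ.< 4 → ∀ {X} → X ℕ.< 850 → 0ℤ ≤ Γ-approx 850 (suc j) X
0≤approx = from-yes (ℕ.allUpTo? (λ j → ℕ.allUpTo? (λ X → 0ℤ ℤ.≤? Γ-approx 850 (suc j) X) 850) 4)

0≤Γ-5≤k : ∀ {j} Y → 4 ℕ.≤ j → 0ℤ ≤ Γ (suc j) (5 ℕ.* suc j ℕ.+ 3 ℕ.+ Y)
0≤Γ-5≤k Y 4≤j = shifted (ℕ.m≤n⇒∃[o]m+o≡n 4≤j)
  where
  shifted : ∀ {j} → ∃[ i ] 4 ℕ.+ i ≡ j → 0ℤ ≤ Γ (suc j) (5 ℕ.* suc j ℕ.+ 3 ℕ.+ Y)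
  shifted (i , refl) = close⇒0≤ (Γ-close (5 ℕ.+ i) _) (slack≤main-5≤k i Y)

0≤Γ-k≤4 : ∀ {j} X → j ℕ.< 4 → 0ℤ ≤ Γ (suc j) X
0≤Γ-k≤4 {j} X j<4 = compare (ℕ.<-≤-connex X 850)
  where
  shifted : ∀ {X} → ∃[ Y ] 850 ℕ.+ Y ≡ X → 0ℤ ≤ Γ (suc j) X
  shifted (Y , refl) = close⇒0≤ (Γ-close (suc j) (850 ℕ.+ Y)) (slack≤main-k≤4 Y (ℕ.≤-pred j<4))
  compare : X ℕ.< 850 ⊎ 850 ℕ.≤ X → 0ℤ ≤ Γ (suc j) X
  compare (inj₁ X<850) = subst (0ℤ ≤_) (sym (Γ≡approx 850 (suc j) X<850)) (0≤approx j<4 X<850)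
  compare (inj₂ 850≤X) = shifted (ℕ.m≤n⇒∃[o]m+o≡n 850≤X)

-- Below 5k + 3 the value is a partition number or a difference of two, so only the large range
-- needs the bounds or the computation.
0≤Γ : ∀ j X → 0ℤ ≤ Γ (suc j) X
0≤Γ j X = nonneg (region (suc j) X)
  where
  nonneg : ∀ {X} → Region (suc j) X → 0ℤ ≤ Γ (suc j) X
  nonneg (small X≤)    = subst (0ℤ ≤_) (sym (Γ-small (suc j) X≤)) (0≤pos _)
  nonneg (mid {Z} Z≤k) = subst (0ℤ ≤_) (sym (Γ-mid (suc j) Z≤k)) (0≤p₂₃₅-difference j Z)
  nonneg (large {Y})   = [ 0≤Γ-k≤4 _ , 0≤Γ-5≤k Y ]′ (ℕ.<-≤-connex j 4)

corollary2p7 : ∀ (k : ℕ) → 1 ℕ.≤ k → ∀ (n : ℕ) → 0ℤ ≤ γ 2 3 5 (+ 5 / 2) (+ 1 / 2) k n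
corollary2p7 (suc j) _ n = [ below , (λ e≤n → above (ℕ.m≤n⇒∃[o]m+o≡n e≤n)) ]′ (ℕ.<-≤-connex n (pent (suc j)))
  where
  below : n ℕ.< pent (suc j) → 0ℤ ≤ γ 2 3 5 5/2 1/2 (suc j) n
  below n< = ℤ.≤-reflexive (sym (γ-< (suc j) n<))
  above : ∀ {n} → ∃[ X ] pent (suc j) ℕ.+ X ≡ n → 0ℤ ≤ γ 2 3 5 5/2 1/2 (suc j) n
  above (X , refl) = 0≤Γ j X
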